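{- The families of morphisms $f: I_{\mathsf{IntPreBiLat}}\to FG$ and $g: I_{\mathsf{Lat}\times\mathsf{Lat}}\to GF$ given by $$f_{\mathbf B}(a)=\langle[a]_1,[a]_2\rangle\ (a\in B),\qquad g_{\langle\mathbf L_1,\mathbf L_2\rangle}=\langle g_{\mathbf L_1},g_{\mathbf L_2}\rangle,\quad g_{\mathbf L_1}(a_1)=[\langle a_1,a_2\rangle]_1,\ g_{\mathbf L_2}(a_2)=[\langle a_1,a_2\rangle]_2\quad(\langle a_1,a_2\rangle\in L_1\times L_2)$$ are natural isomorphisms, so that the categories $\mathsf{Lat}\times\mathsf{Lat}$ and $\mathsf{IntPreBiLat}$ are naturally equivalent.
   Context: A pre-bilattice is an algebra $\langle B,\land,\lor,\otimes,\oplus\rangle$ such that $\langle B,\land,\lor\rangle$ and $\langle B,\otimes,\oplus\rangle$ are lattices (not necessarily bounded, non-empty), with orders $\leq_t$ and $\leq_k$. It is interlaced if each of $\land,\lor,\otimes,\oplus$ is monotone with respect to both $\leq_t$ and $\leq_k$. $\mathsf{IntPreBiLat}$ is the category of interlaced pre-bilattices with all homomorphisms; $\mathsf{Lat}$ is the category of lattices with all lattice homomorphisms. $I_{\mathsf C}$ denotes the identity functor of a category $\mathsf C$. For an interlaced pre-bilattice $\mathbf B$, $\sim_1$ is the equivalence relation associated with the quasi-order $\leq_t\circ\leq_k$ (i.e. $a\mathrel{(\leq_t\circ\leq_k)}b$ iff $a\leq_t c\leq_k b$ for some $c$), and $\sim_2$ the one associated with $\geq_t\circ\leq_k$. Equivalently,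 $a\sim_1 b$ iff $a\lor b=a\otimes b$, and $a\sim_2 b$ iff $a\land b=a\otimes b$. Both are congruences of $\mathbf B$; $[a]_i$ is the class of $a$ modulo $\sim_i$, and $\mathbf B/{\sim_i}$ denotes the quotient lattice of $\langle B,\otimes,\oplus\rangle$. For lattices $\mathbf L_1,\mathbf L_2$ (operations $\sqcap_i,\sqcup_i$), the interlaced pre-bilattice $\mathbf L_1\odot\mathbf L_2$ has universe $L_1\times L_2$ and operations $\langle a_1,a_2\rangle\land\langle b_1,b_2\rangle=\langle a_1\sqcap_1 b_1,a_2\sqcup_2 b_2\rangle$, $\langle a_1,a_2\rangle\lor\langle b_1,b_2\rangle=\langle a_1\sqcup_1 b_1,a_2\sqcap_2 b_2\rangle$, $\langle a_1,a_2\rangle\otimes\langle b_1,b_2\rangle=\langle a_1\sqcap_1 b_1,a_2\sqcap_2 b_2\rangle$, $\langle a_1,a_2\rangle\oplus\langle b_1,b_2\rangle=\langle a_1\sqcup_1 b_1,a_2\sqcup_2 b_2\rangle$. The functor $F:\mathsf{Lat}\times\mathsf{Lat}\to\mathsf{IntPreBiLat}$ is $F(\langle\mathbf L_1,\mathbf L_2\rangle)=\mathbf L_1\odot\mathbf L_2$ and $F(\langle h_1,h_2\rangle)(\langle a_1,a_2\rangle)=\langle h_1(a_1),h_2(a_2)\rangle$. The functor $G:\mathsf{IntPreBiLat}\to\mathsf{Lat}\times\mathsf{Lat}$ is $G(\mathbf B)=\langle\mathbf B/{\sim_1},\mathbf B/{\sim_2}\rangle$ and, for $k:\mathbf B\to\mathbf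 C$, $G(k)=\langle G(k)_1,G(k)_2\rangle$ with $G(k)_i([a]_i)=[k(a)]_i$. The definition of $g_{\mathbf L_1}(a_1)$ does not depend on $a_2$, nor that of $g_{\mathbf L_2}(a_2)$ on $a_1$. -}

module Defs where

open import Level using (Level; suc; _⊔_)
open import Data.Product using (Σ-syntax; ∃-syntax; _×_; _,_; proj₁; proj₂)
open import Function using (flip)
open import Algebra.Core using (Op₂)
open import Algebra.Lattice.Bundles using (Lattice)
open import Algebra.Lattice.Structures using (IsLattice)
open import Algebra.Lattice.Morphism.Structures using (IsLatticeHomomorphism)
import Algebra.Lattice.Morphism.Construct.Composition as Composition
import Algebra.Lattice.Morphism.Construct.Identity as Identity
import Algebra.Lattice.Properties.Lattice as LatticeProperties
open import Data.Product.Relation.Binary.Pointwise.NonDependent using (Pointwise; ×-isEquivalence)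
open import Relation.Binary.Bundles using (Poset)
open import Relation.Binary.Core using (Rel; _⇒_; _Preserves₂_⟶_⟶_)
open import Relation.Binary.Definitions using (Reflexive; Transitive)
open import Relation.Binary.Structures using (IsEquivalence)
import Relation.Binary.Construct.Composition as Comp
open import Relation.Binary.Construct.Interior.Symmetric using (SymInterior)
import Relation.Binary.Construct.Interior.Symmetric as Sym
import Relation.Binary.Construct.NaturalOrder.Left as NaturalOrder
import Relation.Binary.Lattice as Order
import Relation.Binary.Lattice.Properties.JoinSemilattice as JoinProperties
import Relation.Binary.Lattice.Properties.MeetSemilattice as MeetProperties

record Category (o h e : Level) : Set (suc (o ⊔ h ⊔ e)) where
  infix  4 _≈_
  infixr 9 _∘_
  field
    Obj       : Set o
    Hom       : Obj → Obj → Set h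
    _≈_       : ∀ {A B} → Rel (Hom A B) e
    id        : ∀ {A} → Hom A A
    _∘_       : ∀ {A B C} → Hom B C → Hom A B → Hom A C
    equiv     : ∀ {A B} → IsEquivalence (_≈_ {A} {B})
    ∘-resp-≈  : ∀ {A B C} {f f′ : Hom B C} {g g′ : Hom A B} →
                f ≈ f′ → g ≈ g′ → f ∘ g ≈ f′ ∘ g′
    identityˡ : ∀ {A B} {f : Hom A B} → id ∘ f ≈ f
    identityʳ : ∀ {A B} {f : Hom A B} → f ∘ id ≈ f
    assoc     : ∀ {A B C D} {f : Hom C D} {g : Hom B C} {k : Hom A B} →
                (f ∘ g) ∘ k ≈ f ∘ (g ∘ k)

  IsIso : ∀ {A B} → Hom A B → Set (h ⊔ e)
  IsIso {A} {B} f = ∃[ g ] (g ∘ f ≈ id {A}) × (f ∘ g ≈ id {B})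

infixr 2 _×ᶜ_

_×ᶜ_ : ∀ {o h e o′ h′ e′} → Category o h e → Category o′ h′ e′ →
       Category (o ⊔ o′) (h ⊔ h′) (e ⊔ e′)
C ×ᶜ D = record
  { Obj       = C.Obj × D.Obj
  ; Hom       = λ (A , A′) (B , B′) → C.Hom A B × D.Hom A′ B′
  ; _≈_       = λ (f , f′) (g , g′) → (f C.≈ g) × (f′ D.≈ g′)
  ; id        = C.id , D.id
  ; _∘_       = λ (f , f′) (g , g′) → f C.∘ g , f′ D.∘ g′
  ; equiv     = record
    { refl  = C.E.refl , D.E.refl
    ; sym   = λ (p , q) → C.E.sym p , D.E.sym q
    ; trans = λ (p , q) (r , s) → C.E.trans p r , D.E.trans q s
    }
  ; ∘-resp-≈  = λ (p , q) (r , s) → C.∘-resp-≈ p r , D.∘-resp-≈ q s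
  ; identityˡ = C.identityˡ , D.identityˡ
  ; identityʳ = C.identityʳ , D.identityʳ
  ; assoc     = C.assoc , D.assoc
  }
  where
  module C where
    open Category C public
    module E {A} {B} = IsEquivalence (equiv {A} {B})
  module D where
    open Category D public
    module E {A} {B} = IsEquivalence (equiv {A} {B})

record Functor {o h e o′ h′ e′ : Level} (C : Category o h e) (D : Category o′ h′ e′) :
               Set (o ⊔ h ⊔ e ⊔ o′ ⊔ h′ ⊔ e′) where
  private
    module C = Category C
    module D = Category D
  field
    F₀       : C.Obj → D.Obj
    F₁       : ∀ {A B} → C.Hom A B → D.Hom (F₀ A) (F₀ B)
    F-resp-≈ : ∀ {A B} {f g : C.Hom A B} → f C.≈ g → F₁ f D.≈ F₁ g
    identity : ∀ {A} → F₁ (C.id {A}) D.≈ D.id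
    homo     : ∀ {X Y Z} {f : C.Hom X Y} {g : C.Hom Y Z} →
               F₁ (g C.∘ f) D.≈ F₁ g D.∘ F₁ f

I : ∀ {o h e} (C : Category o h e) → Functor C C
I C = record
  { F₀       = λ A → A
  ; F₁       = λ f → f
  ; F-resp-≈ = λ p → p
  ; identity = E.refl
  ; homo     = E.refl
  }
  where module E {A} {B} = IsEquivalence (Category.equiv C {A} {B})

infixr 9 _∘ᶠ_

_∘ᶠ_ : ∀ {o h e o′ h′ e′ o″ h″ e″} {C : Category o h e} {D : Category o′ h′ e′}
       {E : Category o″ h″ e″} → Functor D E → Functor C D → Functor C E
_∘ᶠ_ {E = E} H K = record
  { F₀       = λ A → H.F₀ (K.F₀ A)
  ; F₁       = λ f → H.F₁ (K.F₁ f)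
  ; F-resp-≈ = λ p → H.F-resp-≈ (K.F-resp-≈ p)
  ; identity = E.trans (H.F-resp-≈ K.identity) H.identity
  ; homo     = E.trans (H.F-resp-≈ K.homo) H.homo
  }
  where
  module H = Functor H
  module K = Functor K
  module E {A} {B} = IsEquivalence (Category.equiv E {A} {B})

module _ {o h e o′ h′ e′ : Level} {C : Category o h e} {D : Category o′ h′ e′}
         (H K : Functor C D) where
  private
    module C = Category C
    module D = Category D
    module H = Functor H
    module K = Functor K

  Family : Set (o ⊔ h′)
  Family = ∀ A → D.Hom (H.F₀ A) (K.F₀ A)

  IsNatural : Family → Set (o ⊔ h ⊔ e′)
  IsNatural η = ∀ {A B} (k : C.Hom A B) → η B D.∘ H.F₁ k D.≈ K.F₁ k D.∘ η A

  IsNaturalIsomorphism : Family → Set (o ⊔ h ⊔ h′ ⊔ e′)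
  IsNaturalIsomorphism η = IsNatural η × (∀ A → D.IsIso (η A))

  NaturalIsomorphism : Set (o ⊔ h ⊔ h′ ⊔ e′)
  NaturalIsomorphism = Σ[ η ∈ Family ] IsNaturalIsomorphism η

NaturallyEquivalent : ∀ {o h e o′ h′ e′} → Category o h e → Category o′ h′ e′ →
                      Set (o ⊔ h ⊔ e ⊔ o′ ⊔ h′ ⊔ e′)
NaturallyEquivalent C D =
  Σ[ H ∈ Functor C D ] Σ[ K ∈ Functor D C ]
    NaturalIsomorphism (I C) (K ∘ᶠ H) × NaturalIsomorphism (I D) (H ∘ᶠ K)

-- Universes of algebras are non-empty, so an element is part of the object;
-- homomorphisms are not required to preserve it.
record NonEmptyLattice (ℓ : Level) : Set (suc ℓ) where
  field
    lattice : Lattice ℓ ℓ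
  open Lattice lattice public
  field
    element : Carrier

record LatticeHom {ℓ : Level} (L M : NonEmptyLattice ℓ) : Set ℓ where
  private
    module L = NonEmptyLattice L
    module M = NonEmptyLattice M
  field
    ⟦_⟧    : L.Carrier → M.Carrier
    isHom : IsLatticeHomomorphism L.rawLattice M.rawLattice ⟦_⟧
  open IsLatticeHomomorphism isHom public

Lat : ∀ ℓ → Category (suc ℓ) ℓ ℓ
Lat ℓ = record
  { Obj       = NonEmptyLattice ℓ
  ; Hom       = LatticeHom
  ; _≈_       = λ {L} {M} h k → (a : Carrier L) → _≈_ M (⟦ h ⟧ a) (⟦ k ⟧ a)
  ; id        = λ {L} → record
    { isHom = Identity.isLatticeHomomorphism (rawLattice L) (refl L) }
  ; _∘_       = λ {_} {_} {N} h k → record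
    { isHom = Composition.isLatticeHomomorphism (trans N) (isHom k) (isHom h) }
  ; equiv     = λ {_} {M} → record
    { refl  = λ _ → refl M
    ; sym   = λ p a → sym M (p a)
    ; trans = λ p q a → trans M (p a) (q a)
    }
  ; ∘-resp-≈  = λ {_} {_} {N} {f = f} {g′ = g′} p q a →
                  trans N (⟦⟧-cong f (q a)) (p (⟦ g′ ⟧ a))
  ; identityˡ = λ {_} {M} _ → refl M
  ; identityʳ = λ {_} {M} _ → refl M
  ; assoc     = λ {_} {_} {_} {N} _ → refl N
  }
  where
  open LatticeHom
  open NonEmptyLattice using (Carrier; _≈_; rawLattice; refl; sym; trans)

record PreBilattice (ℓ : Level) : Set (suc ℓ) where
  infix 4 _≈_ _≤ₜ_ _≤ₖ_ _≥ₜ_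
  field
    Carrier    : Set ℓ
    _≈_        : Rel Carrier ℓ
    _∧_ _∨_    : Op₂ Carrier
    _⊗_ _⊕_    : Op₂ Carrier
    isLatticeₜ : IsLattice _≈_ _∨_ _∧_
    isLatticeₖ : IsLattice _≈_ _⊕_ _⊗_
    element    : Carrier

  latticeₜ latticeₖ : Lattice ℓ ℓ
  latticeₜ = record { isLattice = isLatticeₜ }
  latticeₖ = record { isLattice = isLatticeₖ }

  _≤ₜ_ _≤ₖ_ _≥ₜ_ : Rel Carrier ℓ
  _≤ₜ_ = NaturalOrder._≤_ _≈_ _∧_
  _≤ₖ_ = NaturalOrder._≤_ _≈_ _⊗_
  _≥ₜ_ = flip _≤ₜ_

  module T = Lattice latticeₜ using (rawLattice)
  module K = Lattice latticeₖ using (rawLattice)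
  open Lattice latticeₜ public using (refl; sym; trans; isEquivalence)

record IsInterlaced {ℓ : Level} (B : PreBilattice ℓ) : Set ℓ where
  open PreBilattice B
  field
    ∧-monoₜ : _∧_ Preserves₂ _≤ₜ_ ⟶ _≤ₜ_ ⟶ _≤ₜ_
    ∧-monoₖ : _∧_ Preserves₂ _≤ₖ_ ⟶ _≤ₖ_ ⟶ _≤ₖ_
    ∨-monoₜ : _∨_ Preserves₂ _≤ₜ_ ⟶ _≤ₜ_ ⟶ _≤ₜ_
    ∨-monoₖ : _∨_ Preserves₂ _≤ₖ_ ⟶ _≤ₖ_ ⟶ _≤ₖ_
    ⊗-monoₜ : _⊗_ Preserves₂ _≤ₜ_ ⟶ _≤ₜ_ ⟶ _≤ₜ_
    ⊗-monoₖ : _⊗_ Preserves₂ _≤ₖ_ ⟶ _≤ₖ_ ⟶ _≤ₖ_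
    ⊕-monoₜ : _⊕_ Preserves₂ _≤ₜ_ ⟶ _≤ₜ_ ⟶ _≤ₜ_
    ⊕-monoₖ : _⊕_ Preserves₂ _≤ₖ_ ⟶ _≤ₖ_ ⟶ _≤ₖ_

record InterlacedPreBilattice (ℓ : Level) : Set (suc ℓ) where
  field
    preBilattice : PreBilattice ℓ
    isInterlaced : IsInterlaced preBilattice
  open PreBilattice preBilattice public
  open IsInterlaced isInterlaced public

record BilatticeHom {ℓ : Level} (B C : InterlacedPreBilattice ℓ) : Set ℓ where
  private
    module B = InterlacedPreBilattice B
    module C = InterlacedPreBilattice C
  field
    ⟦_⟧     : B.Carrier → C.Carrier
    isHomₜ : IsLatticeHomomorphism B.T.rawLattice C.T.rawLattice ⟦_⟧
    isHomₖ : IsLatticeHomomorphism B.K.rawLattice C.K.rawLattice ⟦_⟧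
  open IsLatticeHomomorphism isHomₜ public
  open IsLatticeHomomorphism isHomₖ public using ()
    renaming (∧-homo to ⊗-homo; ∨-homo to ⊕-homo)

IntPreBiLat : ∀ ℓ → Category (suc ℓ) ℓ ℓ
IntPreBiLat ℓ = record
  { Obj       = InterlacedPreBilattice ℓ
  ; Hom       = BilatticeHom
  ; _≈_       = λ {B} {C} h k → (a : Carrier B) → _≈_ C (⟦ h ⟧ a) (⟦ k ⟧ a)
  ; id        = λ {B} → record
    { isHomₜ = Identity.isLatticeHomomorphism (T.rawLattice B) (refl B)
    ; isHomₖ = Identity.isLatticeHomomorphism (K.rawLattice B) (refl B)
    }
  ; _∘_       = λ {_} {_} {D} h k → record
    { isHomₜ = Composition.isLatticeHomomorphism (trans D) (isHomₜ k) (isHomₜ h)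
    ; isHomₖ = Composition.isLatticeHomomorphism (trans D) (isHomₖ k) (isHomₖ h)
    }
  ; equiv     = λ {_} {C} → record
    { refl  = λ _ → refl C
    ; sym   = λ p a → sym C (p a)
    ; trans = λ p q a → trans C (p a) (q a)
    }
  ; ∘-resp-≈  = λ {_} {_} {D} {f = f} {g′ = g′} p q a →
                  trans D (⟦⟧-cong f (q a)) (p (⟦ g′ ⟧ a))
  ; identityˡ = λ {_} {C} _ → refl C
  ; identityʳ = λ {_} {C} _ → refl C
  ; assoc     = λ {_} {_} {_} {D} _ → refl D
  }
  where
  open BilatticeHom
  open InterlacedPreBilattice using (Carrier; _≈_; refl; sym; trans; module T; module K)

private
  module Mono {c ℓ} (L : Lattice c ℓ) where
    open Lattice L
    open LatticeProperties L using (poset; ∨-∧-orderTheoreticLattice)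
    open Poset poset using (_≤_)
    open Order.Lattice ∨-∧-orderTheoreticLattice using (joinSemilattice; meetSemilattice)

    ∨-mono : _∨_ Preserves₂ _≤_ ⟶ _≤_ ⟶ _≤_
    ∨-mono = JoinProperties.∨-monotonic joinSemilattice

    ∧-mono : _∧_ Preserves₂ _≤_ ⟶ _≤_ ⟶ _≤_
    ∧-mono = MeetProperties.∧-monotonic meetSemilattice

  ×-isLattice : ∀ {c ℓ} (L M : Lattice c ℓ) →
    IsLattice (Pointwise (Lattice._≈_ L) (Lattice._≈_ M))
      (λ (a₁ , a₂) (b₁ , b₂) → Lattice._∨_ L a₁ b₁ , Lattice._∨_ M a₂ b₂)
      (λ (a₁ , a₂) (b₁ , b₂) → Lattice._∧_ L a₁ b₁ , Lattice._∧_ M a₂ b₂)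
  ×-isLattice L M = record
    { isEquivalence = ×-isEquivalence L.isEquivalence M.isEquivalence
    ; ∨-comm        = λ _ _ → L.∨-comm _ _ , M.∨-comm _ _
    ; ∨-assoc       = λ _ _ _ → L.∨-assoc _ _ _ , M.∨-assoc _ _ _
    ; ∨-cong        = λ (p , q) (r , s) → L.∨-cong p r , M.∨-cong q s
    ; ∧-comm        = λ _ _ → L.∧-comm _ _ , M.∧-comm _ _
    ; ∧-assoc       = λ _ _ _ → L.∧-assoc _ _ _ , M.∧-assoc _ _ _
    ; ∧-cong        = λ (p , q) (r , s) → L.∧-cong p r , M.∧-cong q s
    ; absorptive    = (λ _ _ → L.∨-absorbs-∧ _ _ , M.∨-absorbs-∧ _ _)
                    , (λ _ _ → L.∧-absorbs-∨ _ _ , M.∧-absorbs-∨ _ _)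
    }
    where
    module L = Lattice L
    module M = Lattice M

infixr 7 _⊙_

_⊙_ : ∀ {ℓ} → NonEmptyLattice ℓ → NonEmptyLattice ℓ → InterlacedPreBilattice ℓ
L₁ ⊙ L₂ = record
  { preBilattice = record
    { Carrier    = L₁.Carrier × L₂.Carrier
    ; _≈_        = Pointwise L₁._≈_ L₂._≈_
    ; _∧_        = λ (a₁ , a₂) (b₁ , b₂) → a₁ L₁.∧ b₁ , a₂ L₂.∨ b₂
    ; _∨_        = λ (a₁ , a₂) (b₁ , b₂) → a₁ L₁.∨ b₁ , a₂ L₂.∧ b₂
    ; _⊗_        = λ (a₁ , a₂) (b₁ , b₂) → a₁ L₁.∧ b₁ , a₂ L₂.∧ b₂
    ; _⊕_        = λ (a₁ , a₂) (b₁ , b₂) → a₁ L₁.∨ b₁ , a₂ L₂.∨ b₂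
    ; isLatticeₜ = ×-isLattice L₁.lattice L₂ᵈ
    ; isLatticeₖ = ×-isLattice L₁.lattice L₂.lattice
    ; element    = L₁.element , L₂.element
    }
  ; isInterlaced = record
    { ∧-monoₜ = λ (p , q) (r , s) → M₁.∧-mono p r , M₂ᵈ.∧-mono q s
    ; ∧-monoₖ = λ (p , q) (r , s) → M₁.∧-mono p r , M₂.∨-mono q s
    ; ∨-monoₜ = λ (p , q) (r , s) → M₁.∨-mono p r , M₂ᵈ.∨-mono q s
    ; ∨-monoₖ = λ (p , q) (r , s) → M₁.∨-mono p r , M₂.∧-mono q s
    ; ⊗-monoₜ = λ (p , q) (r , s) → M₁.∧-mono p r , M₂ᵈ.∨-mono q s
    ; ⊗-monoₖ = λ (p , q) (r , s) → M₁.∧-mono p r , M₂.∧-mono q s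
    ; ⊕-monoₜ = λ (p , q) (r , s) → M₁.∨-mono p r , M₂ᵈ.∧-mono q s
    ; ⊕-monoₖ = λ (p , q) (r , s) → M₁.∨-mono p r , M₂.∨-mono q s
    }
  }
  where
  module L₁ = NonEmptyLattice L₁
  module L₂ = NonEmptyLattice L₂
  L₂ᵈ : Lattice _ _
  L₂ᵈ = LatticeProperties.∧-∨-lattice L₂.lattice
  module M₁ = Mono L₁.lattice
  module M₂ = Mono L₂.lattice
  module M₂ᵈ = Mono L₂ᵈ

module _ {ℓ : Level} {L₁ L₂ M₁ M₂ : NonEmptyLattice ℓ}
         (h₁ : LatticeHom L₁ M₁) (h₂ : LatticeHom L₂ M₂) where
  private
    module H₁ = LatticeHom h₁
    module H₂ = LatticeHom h₂

  ⊙-hom : BilatticeHom (L₁ ⊙ L₂) (M₁ ⊙ M₂)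
  ⊙-hom = record
    { ⟦_⟧    = λ (a₁ , a₂) → H₁.⟦ a₁ ⟧ , H₂.⟦ a₂ ⟧
    ; isHomₜ = record
      { isRelHomomorphism = record { cong = λ (p , q) → H₁.⟦⟧-cong p , H₂.⟦⟧-cong q }
      ; ∧-homo            = λ _ _ → H₁.∧-homo _ _ , H₂.∨-homo _ _
      ; ∨-homo            = λ _ _ → H₁.∨-homo _ _ , H₂.∧-homo _ _
      }
    ; isHomₖ = record
      { isRelHomomorphism = record { cong = λ (p , q) → H₁.⟦⟧-cong p , H₂.⟦⟧-cong q }
      ; ∧-homo            = λ _ _ → H₁.∧-homo _ _ , H₂.∧-homo _ _
      ; ∨-homo            = λ _ _ → H₁.∨-homo _ _ , H₂.∨-homo _ _
      }
    }

F : ∀ ℓ → Functor (Lat ℓ ×ᶜ Lat ℓ) (IntPreBiLat ℓ)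
F ℓ = record
  { F₀       = λ (L₁ , L₂) → L₁ ⊙ L₂
  ; F₁       = λ (h₁ , h₂) → ⊙-hom h₁ h₂
  ; F-resp-≈ = λ (p , q) (a₁ , a₂) → p a₁ , q a₂
  ; identity = λ {(L₁ , L₂)} _ → NonEmptyLattice.refl L₁ , NonEmptyLattice.refl L₂
  ; homo     = λ {_} {_} {(L₁ , L₂)} _ → NonEmptyLattice.refl L₁ , NonEmptyLattice.refl L₂
  }

module Quotient {ℓ : Level} (B : InterlacedPreBilattice ℓ) where
  open InterlacedPreBilattice B
  private
    module Tₚ = Poset (LatticeProperties.poset latticeₜ)
    module Kₚ = Poset (LatticeProperties.poset latticeₖ)
    module OT = Order.Lattice (LatticeProperties.∨-∧-orderTheoreticLattice latticeₜ)
    module LK = Lattice latticeₖ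

  infix 4 _≲₁_ _≲₂_ _∼₁_ _∼₂_

  _≲₁_ _≲₂_ _∼₁_ _∼₂_ : Rel Carrier ℓ
  a ≲₁ b = ∃[ c ] (a ≤ₜ c) × (c ≤ₖ b)
  a ≲₂ b = ∃[ c ] (a ≥ₜ c) × (c ≤ₖ b)
  _∼₁_ = SymInterior _≲₁_
  _∼₂_ = SymInterior _≲₂_

  private
    commute₁ : ∀ {a b} → ∃[ c ] (a ≤ₖ c) × (c ≤ₜ b) → a ≲₁ b
    commute₁ {a} {b} (c , a≤c , c≤b) = a ∨ b , OT.x≤x∨y a b ,
      Kₚ.trans (∨-monoₖ a≤c (Kₚ.refl {b}))
        (Kₚ.reflexive (Tₚ.antisym (OT.∨-least c≤b (Tₚ.refl {b})) (OT.y≤x∨y c b)))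

    commute₂ : ∀ {a b} → ∃[ c ] (a ≤ₖ c) × (c ≥ₜ b) → a ≲₂ b
    commute₂ {a} {b} (c , a≤c , b≤c) = a ∧ b , OT.x∧y≤x a b ,
      Kₚ.trans (∧-monoₖ a≤c (Kₚ.refl {b}))
        (Kₚ.reflexive (Tₚ.antisym (OT.x∧y≤y c b) (OT.∧-greatest b≤c (Tₚ.refl {b}))))

  ≲₁-refl : Reflexive _≲₁_
  ≲₁-refl = Comp.reflexive _≤ₜ_ _≤ₖ_ Tₚ.refl Kₚ.refl

  ≲₂-refl : Reflexive _≲₂_
  ≲₂-refl = Comp.reflexive _≥ₜ_ _≤ₖ_ Tₚ.refl Kₚ.refl

  ≲₁-trans : Transitive _≲₁_
  ≲₁-trans = Comp.transitive _≤ₜ_ _≤ₖ_ commute₁ Tₚ.trans Kₚ.trans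

  ≲₂-trans : Transitive _≲₂_
  ≲₂-trans = Comp.transitive _≥ₜ_ _≤ₖ_ commute₂ (λ p q → Tₚ.trans q p) Kₚ.trans

  ≈⇒∼₁ : _≈_ ⇒ _∼₁_
  ≈⇒∼₁ p = (_ , Tₚ.reflexive p , Kₚ.refl) Sym., (_ , Tₚ.reflexive (sym p) , Kₚ.refl)

  ≈⇒∼₂ : _≈_ ⇒ _∼₂_
  ≈⇒∼₂ p = (_ , Tₚ.reflexive (sym p) , Kₚ.refl) Sym., (_ , Tₚ.reflexive p , Kₚ.refl)

  ∼₁-isEquivalence : IsEquivalence _∼₁_
  ∼₁-isEquivalence = Sym.isEquivalence ≲₁-refl ≲₁-trans

  ∼₂-isEquivalence : IsEquivalence _∼₂_
  ∼₂-isEquivalence = Sym.isEquivalence ≲₂-refl ≲₂-trans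

  ∼₁-cong : (_∙_ : Op₂ Carrier) → _∙_ Preserves₂ _≤ₜ_ ⟶ _≤ₜ_ ⟶ _≤ₜ_ →
            _∙_ Preserves₂ _≤ₖ_ ⟶ _≤ₖ_ ⟶ _≤ₖ_ → _∙_ Preserves₂ _∼₁_ ⟶ _∼₁_ ⟶ _∼₁_
  ∼₁-cong _∙_ monoₜ monoₖ
    ((_ , p , q) Sym., (_ , r , s)) ((_ , p′ , q′) Sym., (_ , r′ , s′)) =
    (_ , monoₜ p p′ , monoₖ q q′) Sym., (_ , monoₜ r r′ , monoₖ s s′)

  ∼₂-cong : (_∙_ : Op₂ Carrier) → _∙_ Preserves₂ _≤ₜ_ ⟶ _≤ₜ_ ⟶ _≤ₜ_ →
            _∙_ Preserves₂ _≤ₖ_ ⟶ _≤ₖ_ ⟶ _≤ₖ_ → _∙_ Preserves₂ _∼₂_ ⟶ _∼₂_ ⟶ _∼₂_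
  ∼₂-cong _∙_ monoₜ monoₖ
    ((_ , p , q) Sym., (_ , r , s)) ((_ , p′ , q′) Sym., (_ , r′ , s′)) =
    (_ , monoₜ p p′ , monoₖ q q′) Sym., (_ , monoₜ r r′ , monoₖ s s′)

  private
    quotient : (_∼_ : Rel Carrier ℓ) → IsEquivalence _∼_ → _≈_ ⇒ _∼_ →
               _⊗_ Preserves₂ _∼_ ⟶ _∼_ ⟶ _∼_ → _⊕_ Preserves₂ _∼_ ⟶ _∼_ ⟶ _∼_ →
               NonEmptyLattice ℓ
    quotient _∼_ ∼-equiv ≈⇒∼ ⊗-cong ⊕-cong = record
      { lattice = record
        { Carrier   = Carrier
        ; _≈_       = _∼_
        ; _∨_       = _⊕_
        ; _∧_       = _⊗_
        ; isLattice = record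
          { isEquivalence = ∼-equiv
          ; ∨-comm        = λ a b → ≈⇒∼ (LK.∨-comm a b)
          ; ∨-assoc       = λ a b c → ≈⇒∼ (LK.∨-assoc a b c)
          ; ∨-cong        = ⊕-cong
          ; ∧-comm        = λ a b → ≈⇒∼ (LK.∧-comm a b)
          ; ∧-assoc       = λ a b c → ≈⇒∼ (LK.∧-assoc a b c)
          ; ∧-cong        = ⊗-cong
          ; absorptive    = (λ a b → ≈⇒∼ (LK.∨-absorbs-∧ a b))
                          , (λ a b → ≈⇒∼ (LK.∧-absorbs-∨ a b))
          }
        }
      ; element = element
      }

  B/∼₁ B/∼₂ : NonEmptyLattice ℓ
  B/∼₁ = quotient _∼₁_ ∼₁-isEquivalence ≈⇒∼₁
           (∼₁-cong _⊗_ ⊗-monoₜ ⊗-monoₖ) (∼₁-cong _⊕_ ⊕-monoₜ ⊕-monoₖ)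
  B/∼₂ = quotient _∼₂_ ∼₂-isEquivalence ≈⇒∼₂
           (∼₂-cong _⊗_ ⊗-monoₜ ⊗-monoₖ) (∼₂-cong _⊕_ ⊕-monoₜ ⊕-monoₖ)

infix 8 _/∼₁ _/∼₂

_/∼₁ _/∼₂ : ∀ {ℓ} → InterlacedPreBilattice ℓ → NonEmptyLattice ℓ
B /∼₁ = Quotient.B/∼₁ B
B /∼₂ = Quotient.B/∼₂ B

-- The quotient has the carrier of B with a coarser setoid equality, so the class
-- of a is represented by a itself.
_∋[_]₁ : ∀ {ℓ} (B : InterlacedPreBilattice ℓ) →
         InterlacedPreBilattice.Carrier B → NonEmptyLattice.Carrier (B /∼₁)
B ∋[ a ]₁ = a

_∋[_]₂ : ∀ {ℓ} (B : InterlacedPreBilattice ℓ) →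
         InterlacedPreBilattice.Carrier B → NonEmptyLattice.Carrier (B /∼₂)
B ∋[ a ]₂ = a

module _ {ℓ : Level} {B C : InterlacedPreBilattice ℓ} (k : BilatticeHom B C) where
  private
    module B = InterlacedPreBilattice B
    module C = InterlacedPreBilattice C
    module QB = Quotient B
    module QC = Quotient C
    open BilatticeHom k

    monoₜ : ∀ {a b} → a B.≤ₜ b → ⟦ a ⟧ C.≤ₜ ⟦ b ⟧
    monoₜ p = C.trans (⟦⟧-cong p) (∧-homo _ _)

    monoₖ : ∀ {a b} → a B.≤ₖ b → ⟦ a ⟧ C.≤ₖ ⟦ b ⟧
    monoₖ p = C.trans (⟦⟧-cong p) (⊗-homo _ _)

    cong₁ : ∀ {a b} → a QB.∼₁ b → ⟦ a ⟧ QC.∼₁ ⟦ b ⟧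
    cong₁ ((_ , p , q) Sym., (_ , r , s)) =
      (_ , monoₜ p , monoₖ q) Sym., (_ , monoₜ r , monoₖ s)

    cong₂ : ∀ {a b} → a QB.∼₂ b → ⟦ a ⟧ QC.∼₂ ⟦ b ⟧
    cong₂ ((_ , p , q) Sym., (_ , r , s)) =
      (_ , monoₜ p , monoₖ q) Sym., (_ , monoₜ r , monoₖ s)

  _/∼₁-hom : LatticeHom (B /∼₁) (C /∼₁)
  _/∼₁-hom = record
    { ⟦_⟧   = λ a → C ∋[ ⟦ a ⟧ ]₁
    ; isHom = record
      { isRelHomomorphism = record { cong = cong₁ }
      ; ∧-homo            = λ a b → QC.≈⇒∼₁ (⊗-homo a b)
      ; ∨-homo            = λ a b → QC.≈⇒∼₁ (⊕-homo a b)
      }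
    }

  _/∼₂-hom : LatticeHom (B /∼₂) (C /∼₂)
  _/∼₂-hom = record
    { ⟦_⟧   = λ a → C ∋[ ⟦ a ⟧ ]₂
    ; isHom = record
      { isRelHomomorphism = record { cong = cong₂ }
      ; ∧-homo            = λ a b → QC.≈⇒∼₂ (⊗-homo a b)
      ; ∨-homo            = λ a b → QC.≈⇒∼₂ (⊕-homo a b)
      }
    }

G : ∀ ℓ → Functor (IntPreBiLat ℓ) (Lat ℓ ×ᶜ Lat ℓ)
G ℓ = record
  { F₀       = λ B → B /∼₁ , B /∼₂
  ; F₁       = λ k → k /∼₁-hom , k /∼₂-hom
  ; F-resp-≈ = λ {_} {C} p → (λ a → Quotient.≈⇒∼₁ C (p a)) , (λ a → Quotient.≈⇒∼₂ C (p a))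
  ; identity = λ {B} → (λ _ → NonEmptyLattice.refl (B /∼₁)) , (λ _ → NonEmptyLattice.refl (B /∼₂))
  ; homo     = λ {_} {_} {D} → (λ _ → NonEmptyLattice.refl (D /∼₁)) , (λ _ → NonEmptyLattice.refl (D /∼₂))
  }

{-# OPTIONS --safe #-}

-- In an interlaced pre-bilattice, monotonicity and idempotence put a ⊗ b and a ⊕ b between
-- a ∧ b and a ∨ b for ≤ₜ, and a ∧ b and a ∨ b between a ⊗ b and a ⊕ b for ≤ₖ.  So ∧ agrees
-- with ⊗ modulo ∼₁ and with ⊕ modulo ∼₂, dually for ∨, and f is a homomorphism.  It is
-- injective because ≲₁ and ≲₂ together imply ≤ₖ, and surjective because
-- (a ⊗ (a ∨ b)) ⊕ (b ⊗ (a ∧ b)) is ∼₁-equivalent to a and ∼₂-equivalent to b.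
-- In L₁ ⊙ L₂, ∼ᵢ is equality of the i-th coordinates, so the projections are inverse to g.
module Submission where

open import Defs
open import Level using (Level)
open import Data.Product using (Σ-syntax; _×_; _,_; proj₁; proj₂)
open import Algebra.Core using (Op₂)
open import Algebra.Lattice.Bundles using (Lattice)
import Algebra.Lattice.Properties.Lattice as LatticeProperties
open import Relation.Binary.Bundles using (Poset)
open import Relation.Binary.Core using (_Preserves₂_⟶_⟶_)
import Relation.Binary.Construct.Interior.Symmetric as Sym
import Relation.Binary.Lattice as Order
import Relation.Binary.Reasoning.Setoid as SetoidReasoning

-- Monotone idempotent operations on a lattice.

module MonotoneIdempotent {c ℓ} (L : Lattice c ℓ) where
  open Lattice L
  open LatticeProperties L using (poset; ∨-∧-orderTheoreticLattice)
  open Poset poset using (_≤_) renaming (reflexive to ≤-reflexive; trans to ≤-trans)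
  open Order.Lattice ∨-∧-orderTheoreticLattice using (x∧y≤x; x∧y≤y; x≤x∨y; y≤x∨y)

  module _ (_∙_ : Op₂ Carrier) (idem : ∀ a → a ∙ a ≈ a)
           (mono : _∙_ Preserves₂ _≤_ ⟶ _≤_ ⟶ _≤_) where

    ∧≤∙ : ∀ a b → a ∧ b ≤ a ∙ b
    ∧≤∙ a b = ≤-trans (≤-reflexive (sym (idem (a ∧ b)))) (mono (x∧y≤x a b) (x∧y≤y a b))

    ∙≤∨ : ∀ a b → a ∙ b ≤ a ∨ b
    ∙≤∨ a b = ≤-trans (mono (x≤x∨y a b) (y≤x∨y a b)) (≤-reflexive (idem (a ∨ b)))

-- Decomposition of an interlaced pre-bilattice.

module Interlaced {ℓ : Level} (B : InterlacedPreBilattice ℓ) where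
  open InterlacedPreBilattice B
  open Quotient B
  private
    module LT = Lattice latticeₜ
    module LK = Lattice latticeₖ
    module PT = LatticeProperties latticeₜ
    module PK = LatticeProperties latticeₖ
    module T≤ = Poset PT.poset
    module K≤ = Poset PK.poset
    module MT = MonotoneIdempotent latticeₜ
    module MK = MonotoneIdempotent latticeₖ
    module Q₁ = NonEmptyLattice (B /∼₁)
    module Q₂ = NonEmptyLattice (B /∼₂)

  -- Each direction needs only one of the two orders: `a ∧ b ≤ₜ a ⊗ b` gives one and
  -- `a ⊗ b ≤ₖ a ∧ b` the other, with reflexivity for the remaining factor of `≲₁`. The next three
  -- lemmas follow the same pattern.
  ∧∼₁⊗ : ∀ a b → a ∧ b ∼₁ a ⊗ b
  ∧∼₁⊗ a b = (_ , MT.∧≤∙ _⊗_ PK.∧-idem ⊗-monoₜ a b , K≤.refl)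
        Sym., (_ , T≤.refl , MK.∧≤∙ _∧_ PT.∧-idem ∧-monoₖ a b)

  ∨∼₁⊕ : ∀ a b → a ∨ b ∼₁ a ⊕ b
  ∨∼₁⊕ a b = (_ , T≤.refl , MK.∙≤∨ _∨_ PT.∨-idem ∨-monoₖ a b)
        Sym., (_ , MT.∙≤∨ _⊕_ PK.∨-idem ⊕-monoₜ a b , K≤.refl)

  ∧∼₂⊕ : ∀ a b → a ∧ b ∼₂ a ⊕ b
  ∧∼₂⊕ a b = (_ , T≤.refl , MK.∙≤∨ _∧_ PT.∧-idem ∧-monoₖ a b)
        Sym., (_ , MT.∧≤∙ _⊕_ PK.∨-idem ⊕-monoₜ a b , K≤.refl)

  ∨∼₂⊗ : ∀ a b → a ∨ b ∼₂ a ⊗ b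
  ∨∼₂⊗ a b = (_ , MT.∙≤∨ _⊗_ PK.∧-idem ⊗-monoₜ a b , K≤.refl)
        Sym., (_ , T≤.refl , MK.∧≤∙ _∨_ PT.∨-idem ∨-monoₖ a b)

  -- If d ≤ₜ a ≤ₜ c and c, d ≤ₖ b, then a = (a ∧ c) ∨ d ≤ₖ (a ∧ b) ∨ b = b.
  ≲₁∧≲₂⇒≤ₖ : ∀ {a b} → a ≲₁ b → a ≲₂ b → a ≤ₖ b
  ≲₁∧≲₂⇒≤ₖ {a} {b} (c , a≤c , c≤b) (d , d≤a , d≤b) =
    K≤.trans (K≤.reflexive a≈)
      (K≤.trans (∨-monoₖ (∧-monoₖ K≤.refl c≤b) d≤b) (K≤.reflexive ≈b))
    where
    open SetoidReasoning LT.setoid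

    a≈ : a ≈ (a ∧ c) ∨ d
    a≈ = begin
      a             ≈⟨ LT.∨-absorbs-∧ a d ⟨
      a ∨ (a ∧ d)   ≈⟨ LT.∨-congˡ (trans d≤a (LT.∧-comm d a)) ⟨
      a ∨ d         ≈⟨ LT.∨-congʳ a≤c ⟩
      (a ∧ c) ∨ d   ∎

    ≈b : (a ∧ b) ∨ b ≈ b
    ≈b = begin
      (a ∧ b) ∨ b   ≈⟨ LT.∨-comm (a ∧ b) b ⟩
      b ∨ (a ∧ b)   ≈⟨ LT.∨-congˡ (LT.∧-comm a b) ⟩
      b ∨ (b ∧ a)   ≈⟨ LT.∨-absorbs-∧ b a ⟩
      b             ∎

  ∼₁∧∼₂⇒≈ : ∀ {a b} → a ∼₁ b → a ∼₂ b → a ≈ b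
  ∼₁∧∼₂⇒≈ (p Sym., q) (r Sym., s) = K≤.antisym (≲₁∧≲₂⇒≤ₖ p r) (≲₁∧≲₂⇒≤ₖ q s)

  -- In a product, `a ⊗ (a ∨ b)` is `(a₁ , a₂ ∧ b₂)` and `b ⊗ (a ∧ b)` is `(a₁ ∧ b₁ , b₂)`, so their
  -- coordinatewise join is `(a₁ , b₂)`.
  glue : Op₂ Carrier
  glue a b = (a ⊗ (a ∨ b)) ⊕ (b ⊗ (a ∧ b))

  glue∼₁ : ∀ a b → glue a b ∼₁ a
  glue∼₁ a b = begin
    -- Modulo `∼₁` the truth operations become knowledge operations, which leaves an identity of the
    -- quotient lattice.
    (a ⊗ (a ∨ b)) ⊕ (b ⊗ (a ∧ b))   ≈⟨ Q₁.∨-cong (Q₁.∧-congˡ (∨∼₁⊕ a b)) (Q₁.∧-congˡ (∧∼₁⊗ a b)) ⟩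
    (a ⊗ (a ⊕ b)) ⊕ (b ⊗ (a ⊗ b))   ≈⟨ Q₁.∨-cong (Q₁.∧-absorbs-∨ a b) (Q₁.∧-comm b (a ⊗ b)) ⟩
    a ⊕ ((a ⊗ b) ⊗ b)               ≈⟨ Q₁.∨-congˡ (Q₁.∧-assoc a b b) ⟩
    a ⊕ (a ⊗ (b ⊗ b))               ≈⟨ Q₁.∨-absorbs-∧ a (b ⊗ b) ⟩
    a                               ∎
    where open SetoidReasoning Q₁.setoid

  glue∼₂ : ∀ a b → glue a b ∼₂ b
  glue∼₂ a b = begin
    (a ⊗ (a ∨ b)) ⊕ (b ⊗ (a ∧ b))   ≈⟨ Q₂.∨-cong (Q₂.∧-congˡ (∨∼₂⊗ a b)) (Q₂.∧-congˡ (∧∼₂⊕ a b)) ⟩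
    (a ⊗ (a ⊗ b)) ⊕ (b ⊗ (a ⊕ b))   ≈⟨ Q₂.∨-cong (Q₂.sym (Q₂.∧-assoc a a b)) (Q₂.∧-congˡ (Q₂.∨-comm a b)) ⟩
    ((a ⊗ a) ⊗ b) ⊕ (b ⊗ (b ⊕ a))   ≈⟨ Q₂.∨-cong (Q₂.∧-comm (a ⊗ a) b) (Q₂.∧-absorbs-∨ b a) ⟩
    (b ⊗ (a ⊗ a)) ⊕ b               ≈⟨ Q₂.∨-comm (b ⊗ (a ⊗ a)) b ⟩
    b ⊕ (b ⊗ (a ⊗ a))               ≈⟨ Q₂.∨-absorbs-∧ b (a ⊗ a) ⟩
    b                               ∎
    where open SetoidReasoning Q₂.setoid

  toProduct : BilatticeHom B (B /∼₁ ⊙ B /∼₂)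
  toProduct = record
    { ⟦_⟧    = λ a → (B ∋[ a ]₁) , (B ∋[ a ]₂)
    ; isHomₜ = record
      { isRelHomomorphism = record { cong = λ p → ≈⇒∼₁ p , ≈⇒∼₂ p }
      -- The second factor enters the truth order of `⊙` reversed, so `∧` must become a join there.
      ; ∧-homo            = λ a b → ∧∼₁⊗ a b , ∧∼₂⊕ a b
      ; ∨-homo            = λ a b → ∨∼₁⊕ a b , ∨∼₂⊗ a b
      }
    ; isHomₖ = record
      { isRelHomomorphism = record { cong = λ p → ≈⇒∼₁ p , ≈⇒∼₂ p }
      ; ∧-homo            = λ _ _ → Q₁.refl , Q₂.refl
      ; ∨-homo            = λ _ _ → Q₁.refl , Q₂.refl
      }
    }

-- Bijective homomorphisms are isomorphisms.

module _ {ℓ : Level} {B C : InterlacedPreBilattice ℓ} (h : BilatticeHom B C) where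
  private
    module B = InterlacedPreBilattice B
    module C = InterlacedPreBilattice C
    module BT = Lattice B.latticeₜ
    module BK = Lattice B.latticeₖ
    module CT = Lattice C.latticeₜ
    module CK = Lattice C.latticeₖ
    open BilatticeHom h

  -- Nothing is assumed of `s` beyond the section law: that it respects equality and the operations
  -- is checked after applying `h`, and injectivity reflects it back to `B`.
  bijectiveHom-isIso : (∀ {a b} → ⟦ a ⟧ C.≈ ⟦ b ⟧ → a B.≈ b) →
    (s : C.Carrier → B.Carrier) → (∀ c → ⟦ s c ⟧ C.≈ c) →
    Category.IsIso (IntPreBiLat ℓ) {B} {C} h
  bijectiveHom-isIso injective s section = inverse , (λ a → injective (section ⟦ a ⟧)) , section
    where
    s-cong : ∀ {c d} → c C.≈ d → s c B.≈ s d
    s-cong p = injective (C.trans (section _) (C.trans p (C.sym (section _))))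

    s-homo : {_∙_ : Op₂ B.Carrier} {_∘_ : Op₂ C.Carrier} →
      (∀ {c c′ d d′} → c C.≈ c′ → d C.≈ d′ → (c ∘ d) C.≈ (c′ ∘ d′)) →
      (∀ a b → ⟦ a ∙ b ⟧ C.≈ (⟦ a ⟧ ∘ ⟦ b ⟧)) → ∀ c d → s (c ∘ d) B.≈ (s c ∙ s d)
    s-homo ∘-cong homo c d = injective (C.trans (section _)
      (C.sym (C.trans (homo (s c) (s d)) (∘-cong (section c) (section d)))))

    inverse : BilatticeHom C B
    inverse = record
      { ⟦_⟧    = s
      ; isHomₜ = record
        { isRelHomomorphism = record { cong = s-cong }
        ; ∧-homo            = s-homo CT.∧-cong ∧-homo
        ; ∨-homo            = s-homo CT.∨-cong ∨-homo
        }
      ; isHomₖ = record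
        { isRelHomomorphism = record { cong = s-cong }
        ; ∧-homo            = s-homo CK.∧-cong ⊗-homo
        ; ∨-homo            = s-homo CK.∨-cong ⊕-homo
        }
      }

-- The two quotients of a product of lattices.

module Product {ℓ : Level} (L₁ L₂ : NonEmptyLattice ℓ) where
  private
    module L₁ = NonEmptyLattice L₁
    module L₂ = NonEmptyLattice L₂
    module P₁ = LatticeProperties L₁.lattice
    module P₂ = LatticeProperties L₂.lattice
    module O₁ = Poset P₁.poset
    module O₂ = Poset P₂.poset
    module J₁ = Order.Lattice P₁.∨-∧-orderTheoreticLattice
    module J₂ = Order.Lattice P₂.∨-∧-orderTheoreticLattice
  open Quotient (L₁ ⊙ L₂)

  ≲₁⇒≤ : ∀ {a b} → a ≲₁ b → proj₁ a O₁.≤ proj₁ b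
  ≲₁⇒≤ (_ , (p , _) , (q , _)) = O₁.trans p q

  ≲₂⇒≤ : ∀ {a b} → a ≲₂ b → proj₂ a O₂.≤ proj₂ b
  ≲₂⇒≤ {_ , a₂} {_ , b₂} ((_ , c₂) , (_ , p) , (_ , q)) = O₂.trans a₂≤c₂ q
    where
    a₂≤c₂ : a₂ O₂.≤ c₂
    -- `p` is the reversed order in join form, `c₂ ≈ c₂ ∨ a₂`; absorption turns it into meet form.
    a₂≤c₂ = L₂.trans (L₂.sym (L₂.∧-absorbs-∨ a₂ c₂))
      (L₂.∧-congˡ (L₂.trans (L₂.∨-comm a₂ c₂) (L₂.sym p)))

  -- The truth step raises the first coordinate to `b₁` while lowering the second to `a₂ ∧ b₂`; the
  -- knowledge step then raises the second to `b₂`.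
  ≤⇒≲₁ : ∀ {a b} → proj₁ a O₁.≤ proj₁ b → a ≲₁ b
  ≤⇒≲₁ {_ , a₂} {b₁ , b₂} p =
    (b₁ , a₂ L₂.∧ b₂) , (p , L₂.sym (L₂.∨-absorbs-∧ a₂ b₂)) , (O₁.refl , J₂.x∧y≤y a₂ b₂)

  -- A downward truth step lowers the first coordinate to `a₁ ∧ b₁` and raises the second to `b₂`;
  -- the knowledge step then repairs the first.
  ≤⇒≲₂ : ∀ {a b} → proj₂ a O₂.≤ proj₂ b → a ≲₂ b
  ≤⇒≲₂ {a₁ , a₂} {b₁ , b₂} p =
    (a₁ L₁.∧ b₁ , b₂) , (J₁.x∧y≤x a₁ b₁ , b₂≈b₂∨a₂) , (J₁.x∧y≤y a₁ b₁ , O₂.refl)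
    where
    b₂≈b₂∨a₂ : b₂ L₂.≈ b₂ L₂.∨ a₂
    b₂≈b₂∨a₂ = L₂.trans (L₂.sym (L₂.∨-absorbs-∧ b₂ a₂))
      (L₂.∨-congˡ (L₂.trans (L₂.∧-comm b₂ a₂) (L₂.sym p)))

  ∼₁⇒≈ : ∀ {a b} → a ∼₁ b → proj₁ a L₁.≈ proj₁ b
  ∼₁⇒≈ (p Sym., q) = O₁.antisym (≲₁⇒≤ p) (≲₁⇒≤ q)

  ∼₂⇒≈ : ∀ {a b} → a ∼₂ b → proj₂ a L₂.≈ proj₂ b
  ∼₂⇒≈ (p Sym., q) = O₂.antisym (≲₂⇒≤ p) (≲₂⇒≤ q)

  coord≈⇒∼₁ : ∀ {a b} → proj₁ a L₁.≈ proj₁ b → a ∼₁ b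
  coord≈⇒∼₁ p = ≤⇒≲₁ (O₁.reflexive p) Sym., ≤⇒≲₁ (O₁.reflexive (L₁.sym p))

  coord≈⇒∼₂ : ∀ {a b} → proj₂ a L₂.≈ proj₂ b → a ∼₂ b
  coord≈⇒∼₂ p = ≤⇒≲₂ (O₂.reflexive p) Sym., ≤⇒≲₂ (O₂.reflexive (L₂.sym p))

  inject₁ : LatticeHom L₁ ((L₁ ⊙ L₂) /∼₁)
  inject₁ = record
    -- `L₂.element` is an arbitrary filler: the class modulo `∼₁` depends on the first coordinate
    -- alone.
    { ⟦_⟧   = λ a₁ → (L₁ ⊙ L₂) ∋[ a₁ , L₂.element ]₁
    ; isHom = record
      { isRelHomomorphism = record { cong = coord≈⇒∼₁ }
      ; ∧-homo            = λ _ _ → coord≈⇒∼₁ L₁.refl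
      ; ∨-homo            = λ _ _ → coord≈⇒∼₁ L₁.refl
      }
    }

  inject₂ : LatticeHom L₂ ((L₁ ⊙ L₂) /∼₂)
  inject₂ = record
    { ⟦_⟧   = λ a₂ → (L₁ ⊙ L₂) ∋[ L₁.element , a₂ ]₂
    ; isHom = record
      { isRelHomomorphism = record { cong = coord≈⇒∼₂ }
      ; ∧-homo            = λ _ _ → coord≈⇒∼₂ L₂.refl
      ; ∨-homo            = λ _ _ → coord≈⇒∼₂ L₂.refl
      }
    }

  project₁ : LatticeHom ((L₁ ⊙ L₂) /∼₁) L₁
  project₁ = record
    { ⟦_⟧   = proj₁
    ; isHom = record
      { isRelHomomorphism = record { cong = ∼₁⇒≈ }
      ; ∧-homo            = λ _ _ → L₁.refl
      ; ∨-homo            = λ _ _ → L₁.refl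
      }
    }

  project₂ : LatticeHom ((L₁ ⊙ L₂) /∼₂) L₂
  project₂ = record
    { ⟦_⟧   = proj₂
    ; isHom = record
      { isRelHomomorphism = record { cong = ∼₂⇒≈ }
      ; ∧-homo            = λ _ _ → L₂.refl
      ; ∨-homo            = λ _ _ → L₂.refl
      }
    }

-- The natural isomorphisms and the equivalence.

module _ (ℓ : Level) where

  f : Family (I (IntPreBiLat ℓ)) (F ℓ ∘ᶠ G ℓ)
  f = Interlaced.toProduct

  f-isNaturalIsomorphism : IsNaturalIsomorphism (I (IntPreBiLat ℓ)) (F ℓ ∘ᶠ G ℓ) f
  f-isNaturalIsomorphism =
    -- Both sides of the naturality square have the same representatives.
    (λ {_} {C} _ _ → NonEmptyLattice.refl (C /∼₁) , NonEmptyLattice.refl (C /∼₂)) ,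
    λ B → let open Interlaced B in
      bijectiveHom-isIso toProduct (λ (p , q) → ∼₁∧∼₂⇒≈ p q)
        (λ (a , b) → glue a b) (λ (a , b) → glue∼₁ a b , glue∼₂ a b)

  g : Family (I (Lat ℓ ×ᶜ Lat ℓ)) (G ℓ ∘ᶠ F ℓ)
  g (L₁ , L₂) = inject₁ , inject₂
    where open Product L₁ L₂

  g-isNaturalIsomorphism : IsNaturalIsomorphism (I (Lat ℓ ×ᶜ Lat ℓ)) (G ℓ ∘ᶠ F ℓ) g
  g-isNaturalIsomorphism =
    (λ { {_} {M₁ , M₂} _ → let open Product M₁ M₂ in
      -- The two sides may differ in the filler coordinate, since homomorphisms need not preserve
      -- `element`; the classes still agree.
      (λ _ → coord≈⇒∼₁ (NonEmptyLattice.refl M₁)) , (λ _ → coord≈⇒∼₂ (NonEmptyLattice.refl M₂)) }) ,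
    λ (L₁ , L₂) → let open Product L₁ L₂ in
      (project₁ , project₂) ,
      ((λ _ → NonEmptyLattice.refl L₁) , (λ _ → NonEmptyLattice.refl L₂)) ,
      ((λ _ → coord≈⇒∼₁ (NonEmptyLattice.refl L₁)) , (λ _ → coord≈⇒∼₂ (NonEmptyLattice.refl L₂)))

theorem5p6p1 : (ℓ : Level) →
    (Σ[ f ∈ Family (I (IntPreBiLat ℓ)) (F ℓ ∘ᶠ G ℓ) ]
    ((B : InterlacedPreBilattice ℓ) (a : InterlacedPreBilattice.Carrier B) →
    InterlacedPreBilattice._≈_ (B /∼₁ ⊙ B /∼₂)
    (BilatticeHom.⟦_⟧ (f B) a) (B ∋[ a ]₁ , B ∋[ a ]₂))
    × IsNaturalIsomorphism (I (IntPreBiLat ℓ)) (F ℓ ∘ᶠ G ℓ) f)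
    × (Σ[ g ∈ Family (I (Lat ℓ ×ᶜ Lat ℓ)) (G ℓ ∘ᶠ F ℓ) ]
    ((L₁ L₂ : NonEmptyLattice ℓ)
    (a₁ : NonEmptyLattice.Carrier L₁) (a₂ : NonEmptyLattice.Carrier L₂) →
    NonEmptyLattice._≈_ ((L₁ ⊙ L₂) /∼₁)
    (LatticeHom.⟦_⟧ (proj₁ (g (L₁ , L₂))) a₁) ((L₁ ⊙ L₂) ∋[ (a₁ , a₂) ]₁)
    × NonEmptyLattice._≈_ ((L₁ ⊙ L₂) /∼₂)
    (LatticeHom.⟦_⟧ (proj₂ (g (L₁ , L₂))) a₂) ((L₁ ⊙ L₂) ∋[ (a₁ , a₂) ]₂))
    × IsNaturalIsomorphism (I (Lat ℓ ×ᶜ Lat ℓ)) (G ℓ ∘ᶠ F ℓ) g)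
    × NaturallyEquivalent (Lat ℓ ×ᶜ Lat ℓ) (IntPreBiLat ℓ)
theorem5p6p1 ℓ =
  (f ℓ ,
   (λ B _ → NonEmptyLattice.refl (B /∼₁) , NonEmptyLattice.refl (B /∼₂)) ,
   f-isNaturalIsomorphism ℓ) ,
  (g ℓ ,
   (λ L₁ L₂ _ _ → let open Product L₁ L₂ in
     coord≈⇒∼₁ (NonEmptyLattice.refl L₁) , coord≈⇒∼₂ (NonEmptyLattice.refl L₂)) ,
   g-isNaturalIsomorphism ℓ) ,
  F ℓ , G ℓ , (g ℓ , g-isNaturalIsomorphism ℓ) , (f ℓ , f-isNaturalIsomorphism ℓ)
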